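{- Let $D$ be a digraph obtained from a tournament by deleting the edges of $2$ disjoint stars, and let $\Delta$ be the dependency digraph of $D$. If $\Delta$ has neither a source nor a sink and $D$ has no sink, then $D$ has at least two vertices with the second neighborhood property, that is, there are at least two distinct vertices $v\in V(D)$ with $d^+_D(v)\le d^{++}_D(v)$.
   Context: All digraphs are finite. A tournament is a digraph without loops in which every two distinct vertices are joined by exactly one arc. Write $x\rightarrow y$ if $(x,y)$ is an arc. $N^+(v)$ is the set of out-neighbors of $v$ and $N^{++}(v)$ is the set of vertices at distance exactly $2$ from $v$ (reached from $v$ by a directed path of length 2 but not by one of length 0 or 1); $d^+(v)=|N^+(v)|$, $d^{++}(v)=|N^{++}(v)|$. In any digraph, a sink is a vertex of out-degree $0$ and a source is a vertex of in-degree $0$. For distinct vertices $x,y$ of $D$, $xy$ is a missing edge if neither $(x,y)$ nor $(y,x)$ is an arc of $D$. A star of center $x$ is a graph whose edge set has the form $\{a_ix : i=1,\dots,k\}$ with $k\ge 1$, the $a_i$ distinct and different from $x$. Stars are disjoint if they share no vertex. Deleting the edges of the stars from a tournament means removing the arc joining the two endpoints of each star edge; thus the missing edges of $D$ are exactly the edges of the two stars. Dependency digraph: for missing edges $e$ and $e'$ of $D$, $e$ loses to $e'$ if the endpoints can be named $e=x_1y_1$, $e'=x_2y_2$ so that $x_1\rightarrow x_2$, $y_2\notin N^+(x_1)\cup N^{++}(x_1)$, $y_1\rightarrow y_2$ and $x_2\notin N^+(y_1)\cup N^{++}(y_1)$. The dependency digraph $\Delta$ of $D$ has the missing edges of $D$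 as vertices, and an arc $(e,e')$ whenever $e$ loses to $e'$ (digons in $\Delta$ are allowed). -}

module Defs where

open import Data.Fin.Base using (Fin)
open import Data.Fin.Properties using (any?; _≟_)
open import Data.Fin.Subset
  using (Subset; _∈_; _∉_; Nonempty; Empty; ⁅_⁆; _∪_; _∩_; ∣_∣)
open import Data.Fin.Subset.Properties using (_∈?_)
open import Data.Nat.Base using (ℕ; _≤_)
open import Data.Product.Base using (∃; ∃₂; _×_)
open import Data.Refinement using (Refinement-syntax; value)
open import Data.Sum.Base using (_⊎_)
open import Data.Vec.Base using (tabulate)
open import Level using (0ℓ)
open import Relation.Binary.Core using (Rel)
open import Relation.Binary.Definitions using (Decidable; Irreflexive)
open import Relation.Binary.PropositionalEquality.Core using (_≡_; _≢_)
open import Relation.Nullary.Decidable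
  using (does; _×-dec_; _⊎-dec_; ¬?)
open import Relation.Nullary.Negation.Core using (¬_)
import Relation.Unary as U

private
  variable
    n : ℕ

-- Δ is a digraph on missing edges rather than on some Fin n, so sinks and
-- sources are defined for an arbitrary arc relation.

module _ {V : Set} (_⟶_ : Rel V 0ℓ) where

  Sink : V → Set
  Sink v = ∀ w → ¬ (v ⟶ w)

  Source : V → Set
  Source v = ∀ w → ¬ (w ⟶ v)

record Digraph (n : ℕ) : Set₁ where
  infix 4 _⟶_ _⟶?_
  field
    _⟶_  : Rel (Fin n) 0ℓ
    _⟶?_ : Decidable _⟶_

subset : {P : U.Pred (Fin n) 0ℓ} → U.Decidable P → Subset n
subset P? = tabulate (λ x → does (P? x))

module _ (D : Digraph n) where
  open Digraph D

  record IsTournament : Set where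
    field
      loopless : Irreflexive _≡_ _⟶_
      joined   : ∀ x y → x ≢ y →
                 (x ⟶ y × ¬ (y ⟶ x)) ⊎ (y ⟶ x × ¬ (x ⟶ y))

  AtDistance2 : Rel (Fin n) 0ℓ
  AtDistance2 v w = v ≢ w × ¬ (v ⟶ w) × ∃ λ u → v ⟶ u × u ⟶ w

  atDistance2? : Decidable AtDistance2
  atDistance2? v w =
    ¬? (v ≟ w) ×-dec ¬? (v ⟶? w) ×-dec any? (λ u → (v ⟶? u) ×-dec (u ⟶? w))

  N⁺ : Fin n → Subset n
  N⁺ v = subset (v ⟶?_)

  N⁺⁺ : Fin n → Subset n
  N⁺⁺ v = subset (atDistance2? v)

  d⁺ : Fin n → ℕ
  d⁺ v = ∣ N⁺ v ∣

  d⁺⁺ : Fin n → ℕ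
  d⁺⁺ v = ∣ N⁺⁺ v ∣

  SecondNeighborhoodProperty : Fin n → Set
  SecondNeighborhoodProperty v = d⁺ v ≤ d⁺⁺ v

  Missing : Rel (Fin n) 0ℓ
  Missing x y = x ≢ y × ¬ (x ⟶ y) × ¬ (y ⟶ x)

  -- A missing edge xy is unordered, so it is encoded as the subset {x , y}.
  MissingEdge : Set
  MissingEdge =
    [ e ∈ Subset n ∣ (∃₂ λ x y → e ≡ ⁅ x ⁆ ∪ ⁅ y ⁆ × Missing x y) ]

  -- The arc relation of the dependency digraph Δ.
  LosesTo : Rel MissingEdge 0ℓ
  LosesTo e e′ =
    ∃₂ λ x₁ y₁ → ∃₂ λ x₂ y₂ →
      value e  ≡ ⁅ x₁ ⁆ ∪ ⁅ y₁ ⁆ ×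
      value e′ ≡ ⁅ x₂ ⁆ ∪ ⁅ y₂ ⁆ ×
      x₁ ⟶ x₂ × y₂ ∉ N⁺ x₁ ∪ N⁺⁺ x₁ ×
      y₁ ⟶ y₂ × x₂ ∉ N⁺ y₁ ∪ N⁺⁺ y₁

record Star (n : ℕ) : Set where
  field
    center          : Fin n
    leaves          : Subset n
    leaves-nonempty : Nonempty leaves
    center∉leaves   : center ∉ leaves

  vertices : Subset n
  vertices = ⁅ center ⁆ ∪ leaves

  Edge : Rel (Fin n) 0ℓ
  Edge x y = (x ∈ leaves × y ≡ center) ⊎ (y ∈ leaves × x ≡ center)

  edge? : Decidable Edge
  edge? x y =
    ((x ∈? leaves) ×-dec (y ≟ center)) ⊎-dec ((y ∈? leaves) ×-dec (x ≟ center))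

Disjoint : Rel (Star n) 0ℓ
Disjoint S S′ = Empty (Star.vertices S ∩ Star.vertices S′)

infixl 6 _∖_

_∖_ : Digraph n → Star n → Digraph n
D ∖ S = record
  { _⟶_  = λ x y → x ⟶ y × ¬ Edge x y
  ; _⟶?_ = λ x y → (x ⟶? y) ×-dec ¬? (edge? x y)
  }
  where
  open Digraph D
  open Star S

{-# OPTIONS --safe #-}
module Submission where

-- Let x → y be the centres and A, B the leaf sets of the stars. As Δ has no
-- source and no sink, the vertex set J of the stars is a module of D (a vertex
-- outside J dominates all of J or is dominated by all of it), y dominates A and
-- B dominates x. Inside D[J], x has the second neighbourhood property, and so
-- does any vertex that has it in the tournament D[A ∪ B].
-- Make J transitive to turn D into a tournament. By Havet and Thomassé it has
-- two vertices with the property, unless J has no out-neighbour. If neither of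
-- them is in J, both keep the property in D. If one is, it has at least as many
-- second as first out-neighbours outside J; then so does every vertex of J, and
-- the two vertices found in D[J] have the property in D.

open import Defs
open import Data.Bool.Base using (true; false; if_then_else_)
open import Data.Fin.Base as Fin using (Fin)
open import Data.Fin.Properties as Fin using (any?; _≟_)
open import Data.Fin.Subset as Subset using (Subset; ⁅_⁆; ∣_∣)
open import Data.Fin.Subset.Properties
  using (_∈?_; ∣⁅x⁆∣≡1; ⊆-antisym; x∈⁅x⁆; x∈⁅y⁆⇒x≡y; x∈⁅y⁆⇔x≡y; ∪-comm; ∩-comm; x∈p∪q⁻; x∈p∪q⁺; x∈p∩q⁺)
open import Data.Irrelevant using ([_])
open import Data.List.Base as List using (List; []; _∷_; _++_; length; filter; allFin; InitLast; initLast; _∷ʳ′_)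
open import Data.List.Membership.Propositional using (_∈_; find; lose)
open import Data.List.Membership.Propositional.Properties
  using (∈-++⁺ˡ; ∈-++⁺ʳ; ∈-++⁻; ∈-∃++; ∈-filter⁺; ∈-filter⁻; ∈-allFin)
open import Data.List.Properties
  using (++-assoc; ++-identityʳ; filter-++; filter-accept; filter-reject; length-filter; length-++-sucʳ)
open import Data.List.Relation.Binary.Permutation.Propositional
  using (_↭_; refl; prep; swap; trans; ↭-sym; ↭-refl; ↭-trans; ↭⇒↭ₛ)
open import Data.List.Relation.Binary.Permutation.Propositional.Properties
  using (shift; ++⁺ˡ; ∈-resp-↭; ↭-length)
open import Data.List.Relation.Binary.Permutation.Setoid.Properties using (Unique-resp-↭)
open import Data.List.Relation.Unary.All as All using (All; []; _∷_)
import Data.List.Relation.Unary.All.Properties as All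
open import Data.List.Relation.Unary.AllPairs as AllPairs using (_∷_)
open import Data.List.Relation.Unary.Any as Any using (Any; here; there)
open import Data.List.Relation.Unary.Unique.Propositional using (Unique)
open import Data.List.Relation.Unary.Unique.Propositional.Properties using (allFin⁺)
open import Data.Nat.Base using (ℕ; zero; suc; _+_; _*_; _≤_; _<_; z≤n; s≤s)
open import Data.Nat.Properties
  using ( ≤-refl; ≤-reflexive; ≤-trans; ≤-pred; ≮⇒≥; ≰⇒>; <⇒≱; _≤?_; m≤m+n; m≤n+m; *-suc
        ; +-assoc; +-comm; +-suc; +-identityʳ; +-mono-≤; +-monoˡ-≤; +-monoʳ-≤
        ; +-cancelˡ-≤; +-cancelʳ-≤; module ≤-Reasoning )
open import Data.Nat.Tactic.RingSolver using (solve-∀)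
open import Data.Product.Base using (∃; ∃₂; _×_; _,_; proj₁; proj₂)
open import Data.Refinement using (value; _,_)
open import Data.Sum.Base using (_⊎_; inj₁; inj₂; [_,_]′)
open import Data.Vec.Base using (tabulate)
open import Data.Vec.Properties using (lookup∘tabulate; lookup⇒[]=; []=⇒lookup)
open import Function.Base using (_∘_; id)
open import Function.Bundles using (module Equivalence)
open import Level using (0ℓ)
open import Relation.Binary.Core using (Rel)
open import Relation.Binary.Definitions using (Decidable; tri<; tri≈; tri>)
open import Relation.Binary.PropositionalEquality
  using (_≡_; _≢_; refl; sym; cong; cong₂; subst; subst₂; module ≡-Reasoning)
import Relation.Binary.PropositionalEquality as ≡
open import Relation.Nullary.Decidable
  using (Dec; does; yes; no; _×-dec_; _⊎-dec_; _→-dec_; ¬?; decidable-stable; dec-true; dec-false; recompute)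
open import Relation.Nullary.Negation.Core using (¬_; contradiction)
import Relation.Unary as U

private
  variable
    n : ℕ

-- Indicators and counting along lists.

⟦_⟧ : ∀ {A : Set} → Dec A → ℕ
⟦ a? ⟧ = if does a? then 1 else 0

⟦⟧-yes : ∀ {A : Set} (a? : Dec A) → A → ⟦ a? ⟧ ≡ 1
⟦⟧-yes a? a = cong (if_then 1 else 0) (dec-true a? a)

⟦⟧-no : ∀ {A : Set} (a? : Dec A) → ¬ A → ⟦ a? ⟧ ≡ 0
⟦⟧-no a? ¬a = cong (if_then 1 else 0) (dec-false a? ¬a)

⟦⟧-mono : ∀ {A B : Set} (a? : Dec A) (b? : Dec B) → (A → B) → ⟦ a? ⟧ ≤ ⟦ b? ⟧
⟦⟧-mono (no _)  _  _ = z≤n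
⟦⟧-mono (yes a) b? f = ≤-reflexive (sym (⟦⟧-yes b? (f a)))

+-interchange : ∀ a b c d → (a + b) + (c + d) ≡ (a + c) + (b + d)
+-interchange = solve-∀

module _ {V : Set} where

  private
    variable
      P Q R : U.Pred V 0ℓ

  count : U.Decidable P → List V → ℕ
  count P? []       = 0
  count P? (v ∷ vs) = ⟦ P? v ⟧ + count P? vs

  count-++ : (P? : U.Decidable P) → ∀ us vs → count P? (us ++ vs) ≡ count P? us + count P? vs
  count-++ P? []       vs = refl
  count-++ P? (u ∷ us) vs =
    ≡.trans (cong (⟦ P? u ⟧ +_) (count-++ P? us vs)) (sym (+-assoc ⟦ P? u ⟧ _ _))

  count-↭ : (P? : U.Decidable P) → ∀ {us vs} → us ↭ vs → count P? us ≡ count P? vs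
  count-↭ P? refl         = refl
  count-↭ P? (prep u p)   = cong (⟦ P? u ⟧ +_) (count-↭ P? p)
  count-↭ P? (swap u v p) =
    ≡.trans (cong (λ k → ⟦ P? u ⟧ + (⟦ P? v ⟧ + k)) (count-↭ P? p)) (exchange ⟦ P? u ⟧ ⟦ P? v ⟧ _)
    where
    exchange : ∀ a b c → a + (b + c) ≡ b + (a + c)
    exchange = solve-∀
  count-↭ P? (trans p q)  = ≡.trans (count-↭ P? p) (count-↭ P? q)

  count-mono : (P? : U.Decidable P) (Q? : U.Decidable Q) → ∀ vs →
               (∀ {v} → v ∈ vs → P v → Q v) → count P? vs ≤ count Q? vs
  count-mono P? Q? []       f = z≤n
  count-mono P? Q? (v ∷ vs) f =
    +-mono-≤ (⟦⟧-mono (P? v) (Q? v) (f (here refl))) (count-mono P? Q? vs (f ∘ there))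

  count≤length : (P? : U.Decidable P) → ∀ vs → count P? vs ≤ length vs
  count≤length P? []       = z≤n
  count≤length P? (v ∷ vs) = +-mono-≤ (⟦⟧≤1 (P? v)) (count≤length P? vs)
    where
    ⟦⟧≤1 : ∀ {A : Set} (a? : Dec A) → ⟦ a? ⟧ ≤ 1
    ⟦⟧≤1 (yes _) = ≤-refl
    ⟦⟧≤1 (no _)  = z≤n

  count-none : (P? : U.Decidable P) → ∀ vs → (∀ v → ¬ P v) → count P? vs ≡ 0
  count-none P? []       ¬P = refl
  count-none P? (v ∷ vs) ¬P = cong₂ _+_ (⟦⟧-no (P? v) (¬P v)) (count-none P? vs ¬P)

  count-⊆-⊎ : (P? : U.Decidable P) (Q? : U.Decidable Q) (R? : U.Decidable R) →
              (∀ {v} → P v → Q v ⊎ R v) → ∀ vs → count P? vs ≤ count Q? vs + count R? vs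
  count-⊆-⊎ P? Q? R? f []       = z≤n
  count-⊆-⊎ {P = P} {Q = Q} {R = R} P? Q? R? f (v ∷ vs) =
    ≤-trans (+-mono-≤ (pointwise (P? v)) (count-⊆-⊎ P? Q? R? f vs))
            (≤-reflexive (+-interchange ⟦ Q? v ⟧ ⟦ R? v ⟧ _ _))
    where
    pointwise : (p? : Dec (P v)) → ⟦ p? ⟧ ≤ ⟦ Q? v ⟧ + ⟦ R? v ⟧
    pointwise (no _)  = z≤n
    pointwise (yes p) with f p
    ... | inj₁ q = ≤-trans (≤-reflexive (sym (⟦⟧-yes (Q? v) q))) (m≤m+n _ _)
    ... | inj₂ r = ≤-trans (≤-reflexive (sym (⟦⟧-yes (R? v) r))) (m≤n+m _ _)

  count-disjoint-⊎ : (P? : U.Decidable P) (Q? : U.Decidable Q) (R? : U.Decidable R) →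
                     (∀ {v} → Q v → P v) → (∀ {v} → R v → P v) → (∀ {v} → Q v → ¬ R v) →
                     ∀ vs → count Q? vs + count R? vs ≤ count P? vs
  count-disjoint-⊎ P? Q? R? f g d []       = z≤n
  count-disjoint-⊎ {P = P} {Q = Q} {R = R} P? Q? R? f g d (v ∷ vs) =
    ≤-trans (≤-reflexive (+-interchange ⟦ Q? v ⟧ _ ⟦ R? v ⟧ _))
            (+-mono-≤ (pointwise (Q? v)) (count-disjoint-⊎ P? Q? R? f g d vs))
    where
    pointwise : (q? : Dec (Q v)) → ⟦ q? ⟧ + ⟦ R? v ⟧ ≤ ⟦ P? v ⟧
    pointwise (no _)  = ⟦⟧-mono (R? v) (P? v) g
    pointwise (yes q) = ≤-reflexive (≡.trans (cong suc (⟦⟧-no (R? v) (d q))) (sym (⟦⟧-yes (P? v) (f q))))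

  -- Turns an inequality in the tournament on the leaves, whose list is a filtered one, into an
  -- inequality between counts over all vertices.
  count-filter : (P? : U.Decidable P) (Q? : U.Decidable Q) → ∀ vs →
                 count P? (filter Q? vs) ≡ count (λ v → Q? v ×-dec P? v) vs
  count-filter P? Q? []       = refl
  count-filter P? Q? (v ∷ vs) with Q? v
  ... | yes _ = cong (⟦ P? v ⟧ +_) (count-filter P? Q? vs)
  ... | no _  = count-filter P? Q? vs

-- Median orders and the Havet-Thomassé argument for tournaments.

module TournamentOn {V : Set} {_⟶_ : Rel V 0ℓ} (_⟶?_ : Decidable _⟶_)
                    (irrefl : ∀ {u} → ¬ (u ⟶ u)) (asym : ∀ {u v} → u ⟶ v → ¬ (v ⟶ u))
                    (connex : ∀ {u v} → u ≢ v → u ⟶ v ⊎ v ⟶ u)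
                    (L : List V) where

  -- The list is an argument because degrees are compared within segments of a median order as well
  -- as in `L`.
  out inn : V → List V → ℕ
  out v = count (v ⟶?_)
  inn v = count (_⟶? v)

  -- In a tournament `w ⟶ v` says at once that `w` differs from `v` and is no out-neighbour of it.
  -- The middle vertex is restricted to `L`, so that a subtournament is covered too.
  Second : V → V → Set
  Second v w = w ⟶ v × Any (λ u → v ⟶ u × u ⟶ w) L

  second? : ∀ v → U.Decidable (Second v)
  second? v w = (w ⟶? v) ×-dec Any.any? (λ u → (v ⟶? u) ×-dec (u ⟶? w)) L

  second : V → List V → ℕ
  second v = count (second? v)

  SNP : V → Set
  SNP v = out v L ≤ second v L

  weight : List V → ℕ
  weight []       = 0
  weight (v ∷ vs) = out v vs + weight vs

  -- Only the pairs of `b` with entries of `P` change order: arcs from `P` to `b` stop being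
  -- forward, arcs from `b` to `P` become forward. Sums on both sides avoid subtraction.
  weight-shift : ∀ P b Z → weight (P ++ b ∷ Z) + out b P ≡ weight (b ∷ P ++ Z) + inn b P
  weight-shift []      b Z = refl
  weight-shift (p ∷ P) b Z = begin
    out p (P ++ b ∷ Z) + W + (pb + out b P)
      ≡⟨ cong (λ k → k + W + (pb + out b P)) (count-↭ (p ⟶?_) (shift b P Z)) ⟩
    bp + out p (P ++ Z) + W + (pb + out b P)
      ≡⟨ rearrange₁ bp (out p (P ++ Z)) W pb (out b P) ⟩
    (W + out b P) + (bp + out p (P ++ Z) + pb)
      ≡⟨ cong (_+ (bp + out p (P ++ Z) + pb)) (weight-shift P b Z) ⟩
    (out b (P ++ Z) + weight (P ++ Z) + inn b P) + (bp + out p (P ++ Z) + pb)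
      ≡⟨ rearrange₂ (out b (P ++ Z)) (weight (P ++ Z)) (inn b P) bp (out p (P ++ Z)) pb ⟩
    pb + out b (P ++ Z) + (out p (P ++ Z) + weight (P ++ Z)) + (bp + inn b P) ∎
    where
    open ≡-Reasoning
    W  = weight (P ++ b ∷ Z)
    pb = ⟦ b ⟶? p ⟧
    bp = ⟦ p ⟶? b ⟧
    rearrange₁ : ∀ a b c d e → a + b + c + (d + e) ≡ (c + e) + (a + b + d)
    rearrange₁ = solve-∀
    rearrange₂ : ∀ a b c d e f → (a + b + c) + (d + e + f) ≡ f + a + (e + b) + (d + c)
    rearrange₂ = solve-∀

  -- An entry of `X` sees what follows it only up to permutation, so a common prefix does not affect
  -- the exchange.
  weight-++-shift : ∀ X P b Z →
    weight (X ++ P ++ b ∷ Z) + out b P ≡ weight (X ++ b ∷ P ++ Z) + inn b P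
  weight-++-shift []      P b Z = weight-shift P b Z
  weight-++-shift (x ∷ X) P b Z = begin
    out x (X ++ P ++ b ∷ Z) + weight (X ++ P ++ b ∷ Z) + out b P
      ≡⟨ +-assoc (out x (X ++ P ++ b ∷ Z)) _ _ ⟩
    out x (X ++ P ++ b ∷ Z) + (weight (X ++ P ++ b ∷ Z) + out b P)
      ≡⟨ cong₂ _+_ (count-↭ (x ⟶?_) (++⁺ˡ X (shift b P Z))) (weight-++-shift X P b Z) ⟩
    out x (X ++ b ∷ P ++ Z) + (weight (X ++ b ∷ P ++ Z) + inn b P)
      ≡⟨ +-assoc (out x (X ++ b ∷ P ++ Z)) _ _ ⟨
    out x (X ++ b ∷ P ++ Z) + weight (X ++ b ∷ P ++ Z) + inn b P ∎
    where open ≡-Reasoning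

  -- A crude bound; it makes the successive improvements in `¬¬median` stop.
  weight≤length² : ∀ vs → weight vs ≤ length vs * length vs
  weight≤length² []       = z≤n
  weight≤length² (v ∷ vs) = begin
    out v vs + weight vs          ≤⟨ +-mono-≤ (count≤length (v ⟶?_) vs) (weight≤length² vs) ⟩
    l + l * l                     ≤⟨ m≤n+m _ (suc l) ⟩
    suc l + (l + l * l)           ≡⟨ cong (suc l +_) (*-suc l l) ⟨
    suc l * suc l                 ∎
    where
    open ≤-Reasoning
    l = length vs

  -- A median order of T[L]: a permutation of L with the most forward arcs.
  Median : List V → Set
  Median M = M ↭ L × (∀ {M′} → M′ ↭ L → weight M′ ≤ weight M)

  -- If no permutation is optimal, each can be improved; every improvement uses up one unit of the
  -- slack `k` below the bound. The double negation spares an enumeration of permutations and is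
  -- removed at the end, where the goal is decidable.
  ¬¬median : ¬ ¬ ∃ Median
  ¬¬median none = unbounded (length L * length L) ↭-refl (m≤n+m _ _)
    where
    unbounded : ∀ k {M} → M ↭ L → ¬ (length L * length L ≤ weight M + k)
    unbounded k {M} M↭L bound = none (M , M↭L , λ {M′} M′↭L → ≮⇒≥ (better k bound M′↭L))
      where
      better : ∀ k → length L * length L ≤ weight M + k → ∀ {M′} → M′ ↭ L → ¬ (weight M < weight M′)
      better zero    b {M′} M′↭L lt = <⇒≱ lt (begin
        weight M′               ≤⟨ weight≤length² M′ ⟩
        length M′ * length M′   ≡⟨ cong (λ l → l * l) (↭-length M′↭L) ⟩
        length L * length L     ≤⟨ b ⟩
        weight M + 0            ≡⟨ +-identityʳ _ ⟩
        weight M                ∎)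
        where open ≤-Reasoning
      better (suc k) b M′↭L lt = unbounded k M′↭L
        (≤-trans b (≤-trans (≤-reflexive (+-suc _ k)) (+-monoˡ-≤ k lt)))

  -- Otherwise moving `b` in front of the segment `P` just before it would gain forward arcs.
  median-back : ∀ X P {b Z} → Median (X ++ P ++ b ∷ Z) → out b P ≤ inn b P
  median-back X P {b} {Z} (p , max) = +-cancelˡ-≤ (weight (X ++ b ∷ P ++ Z)) _ _ (begin
    weight (X ++ b ∷ P ++ Z) + out b P   ≤⟨ +-monoˡ-≤ _ (max (↭-trans (++⁺ˡ X (↭-sym (shift b P Z))) p)) ⟩
    weight (X ++ P ++ b ∷ Z) + out b P   ≡⟨ weight-++-shift X P b Z ⟩
    weight (X ++ b ∷ P ++ Z) + inn b P   ∎)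
    where open ≤-Reasoning

  -- Under this inequality the move of `b` in front of `P` loses no forward arc on balance, so the
  -- order stays optimal.
  median-move : ∀ X P {b Z} → Median (X ++ P ++ b ∷ Z) → inn b P ≤ out b P → Median (X ++ b ∷ P ++ Z)
  median-move X P {b} {Z} (p , max) le =
    ↭-trans (++⁺ˡ X (↭-sym (shift b P Z))) p , λ q → ≤-trans (max q) no-loss
    where
    open ≤-Reasoning
    no-loss : weight (X ++ P ++ b ∷ Z) ≤ weight (X ++ b ∷ P ++ Z)
    no-loss = +-cancelʳ-≤ (out b P) _ _ (begin
      weight (X ++ P ++ b ∷ Z) + out b P   ≡⟨ weight-++-shift X P b Z ⟩
      weight (X ++ b ∷ P ++ Z) + inn b P   ≤⟨ +-monoʳ-≤ _ le ⟩
      weight (X ++ b ∷ P ++ Z) + out b P   ∎)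

  -- In Havet–Thomassé, c is bad if it dominates y and all out-neighbours of y in L.
  NotBad : V → V → Set
  NotBad y c = c ⟶ y → Second y c

  notBad? : ∀ y → U.Decidable (NotBad y)
  notBad? y c = (c ⟶? y) →-dec second? y c

  bad⇒⟶ : ∀ {y c} → ¬ NotBad y c → c ⟶ y
  bad⇒⟶ {y} {c} bad with c ⟶? y
  ... | yes c⟶y = c⟶y
  ... | no ¬c⟶y = contradiction (λ c⟶y → contradiction c⟶y ¬c⟶y) bad

  -- If `u ⟶ c`, the path from `y` through `u` would make `c` a second out-neighbour of `y`, hence
  -- not bad.
  bad-dominates : ∀ {y c u} → ¬ NotBad y c → u ∈ L → y ⟶ u → c ⟶ u
  bad-dominates {y} {c} {u} bad u∈L y⟶u with connex {c} {u} (λ { refl → asym y⟶u (bad⇒⟶ bad) })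
  ... | inj₁ c⟶u = c⟶u
  ... | inj₂ u⟶c = contradiction (λ c⟶y → c⟶y , lose u∈L (y⟶u , u⟶c)) bad

  -- The same fact read backwards: `y ⟶ u` would force `c ⟶ u`.
  bad-inn : ∀ {y c u} → ¬ NotBad y c → u ∈ L → u ⟶ c → u ⟶ y
  bad-inn {y} {c} {u} bad u∈L u⟶c with connex {u} {y} (λ { refl → asym u⟶c (bad⇒⟶ bad) })
  ... | inj₁ u⟶y = u⟶y
  ... | inj₂ y⟶u = contradiction (bad-dominates bad u∈L y⟶u) (asym u⟶c)

  inn≤second : ∀ {y P} → All (NotBad y) P → inn y P ≤ second y P
  inn≤second {y} {P} nb = count-mono (_⟶? y) (second? y) P λ v∈P → All.lookup nb v∈P

  infix-⊆ : ∀ X P {Z u} → Median (X ++ P ++ Z) → u ∈ P → u ∈ L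
  infix-⊆ X P (p , _) u∈P = ∈-resp-↭ p (∈-++⁺ʳ X (∈-++⁺ˡ u∈P))

  out-bad : ∀ {y c} X P {Z} → Median (X ++ P ++ Z) → ¬ NotBad y c → out y P ≤ out c P
  out-bad {y} {c} X P m bad =
    count-mono (y ⟶?_) (c ⟶?_) P (bad-dominates bad ∘ infix-⊆ X P m)

  inn-bad : ∀ {y c} X P {Z} → Median (X ++ P ++ Z) → ¬ NotBad y c → inn c P ≤ inn y P
  inn-bad {y} {c} X P m bad =
    count-mono (_⟶? c) (_⟶? y) P (bad-inn bad ∘ infix-⊆ X P m)

  ++-∷-snoc : ∀ (X : List V) c Z → X ++ c ∷ Z ≡ (X ++ c ∷ []) ++ Z
  ++-∷-snoc X c Z = sym (++-assoc X (c ∷ []) Z)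

  ++-∷-snocʳ : ∀ (X P : List V) c Z → X ++ P ++ c ∷ Z ≡ X ++ (P ++ c ∷ []) ++ Z
  ++-∷-snocʳ X P c Z = cong (X ++_) (++-∷-snoc P c Z)

  ++-∷-snoc² : ∀ (X P : List V) c Z → X ++ P ++ c ∷ Z ≡ (X ++ P ++ c ∷ []) ++ Z
  ++-∷-snoc² X P c Z = ≡.trans (++-∷-snocʳ X P c Z) (sym (++-assoc X (P ++ c ∷ []) Z))

  -- Bookkeeping for a scan in which `c` passes from the unread part to the part already read.
  count-snoc : ∀ {A : U.Pred V 0ℓ} (A? : U.Decidable A) P c S →
               count A? (P ++ c ∷ []) + count A? S ≡ count A? P + count A? (c ∷ S)
  count-snoc A? P c S = ≡.trans (sym (count-++ A? (P ++ c ∷ []) S))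
    (≡.trans (cong (count A?) (sym (++-∷-snoc P c S))) (count-++ A? P (c ∷ S)))

  -- Havet–Thomassé: P is scanned up to the next bad vertex c, and
  -- out y P ≤ out c P ≤ inn c P ≤ inn y P since c dominates y and all out-neighbours of y.
  feed : ∀ X P S {y Z} → Median (X ++ P ++ S ++ y ∷ Z) → All (NotBad y) P →
         out y P + out y S ≤ second y P + second y S
  feed X P []      m nb = +-monoˡ-≤ 0 (≤-trans (median-back X P m) (inn≤second nb))
  feed X P (c ∷ S) {y} {Z} m nb with notBad? y c
  ... | yes c-nb = begin
    out y P + out y (c ∷ S)                ≡⟨ count-snoc (y ⟶?_) P c S ⟨
    out y (P ++ c ∷ []) + out y S          ≤⟨ feed X (P ++ c ∷ []) S
                                                (subst Median (++-∷-snocʳ X P c _) m) (All.++⁺ nb (c-nb ∷ [])) ⟩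
    second y (P ++ c ∷ []) + second y S    ≡⟨ count-snoc (second? y) P c S ⟩
    second y P + second y (c ∷ S)          ∎
    where open ≤-Reasoning
  ... | no bad = +-mono-≤ P-part (+-mono-≤ (≤-trans (≤-reflexive (⟦⟧-no (y ⟶? c) (asym (bad⇒⟶ bad)))) z≤n) S-part)
    where
    P-part : out y P ≤ second y P
    P-part = ≤-trans (out-bad X P m bad) (≤-trans (median-back X P m)
               (≤-trans (inn-bad X P m bad) (inn≤second nb)))
    -- After a bad vertex the scan starts afresh: everything up to `c` joins the prefix and the
    -- scanned segment is empty again.
    S-part : out y S ≤ second y S
    S-part = feed (X ++ P ++ c ∷ []) [] S (subst Median (++-∷-snoc² X P c _) m) []

  -- Sedimentation: the bad vertices, then y, move to the front at no cost.
  sediment : ∀ X P S {y Z} → Median (X ++ P ++ S ++ y ∷ Z) → All (NotBad y) P →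
             second y P + second y S ≤ out y P + out y S →
             ∃ λ X′ → Median (X′ ++ y ∷ P ++ filter (notBad? y) S ++ Z)
  sediment X P []      {y} m nb le =
    -- All bad vertices have been moved away, so now `y` itself passes over the remaining segment
    -- `P`.
    X , median-move X P m (≤-trans (inn≤second nb) (+-cancelʳ-≤ 0 _ _ le))
  sediment X P (c ∷ S) {y} {Z} m nb le with notBad? y c
  ... | yes c-nb with sediment X (P ++ c ∷ []) S (subst Median (++-∷-snocʳ X P c _) m) (All.++⁺ nb (c-nb ∷ []))
                        (≤-trans (≤-reflexive (count-snoc (second? y) P c S))
                          (≤-trans le (≤-reflexive (sym (count-snoc (y ⟶?_) P c S)))))
  ...   | X′ , m′ = X′ , subst (λ W → Median (X′ ++ y ∷ W)) 
                        (≡.trans (sym (++-∷-snoc P c _)) (cong (λ F → P ++ F ++ Z) (sym (filter-accept (notBad? y) c-nb)))) m′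
  sediment X P (c ∷ S) {y} {Z} m nb le | no bad =
    let X′ , m′ = sediment (X ++ c ∷ []) P S (subst Median (++-∷-snoc X c _) moved) nb le′
    in  X′ , subst (λ F → Median (X′ ++ y ∷ P ++ F ++ Z)) (sym (filter-reject (notBad? y) bad)) m′
    where
    open ≤-Reasoning
    S-part : out y S ≤ second y S
    S-part = feed (X ++ P ++ c ∷ []) [] S (subst Median (++-∷-snoc² X P c _) m) []
    le′ : second y P + second y S ≤ out y P + out y S
    le′ = begin
      second y P + second y S        ≤⟨ +-monoʳ-≤ (second y P) (m≤n+m _ ⟦ second? y c ⟧) ⟩
      second y P + second y (c ∷ S)  ≤⟨ le ⟩
      out y P + out y (c ∷ S)        ≡⟨ cong (λ k → out y P + (k + out y S)) (⟦⟧-no (y ⟶? c) (asym (bad⇒⟶ bad))) ⟩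
      out y P + out y S              ∎
    -- `feed` bounds the part in `S` from the other side, so the reversed inequality must hold on
    -- `P` alone; this is what makes moving `c` free.
    P-part : second y P ≤ out y P
    P-part = +-cancelʳ-≤ (second y S) _ _ (≤-trans le′ (+-monoʳ-≤ (out y P) S-part))
    moved : Median (X ++ c ∷ P ++ S ++ y ∷ Z)
    moved = median-move X P m (begin
      inn c P      ≤⟨ inn-bad X P m bad ⟩
      inn y P      ≤⟨ inn≤second nb ⟩
      second y P   ≤⟨ P-part ⟩
      out y P      ≤⟨ out-bad X P m bad ⟩
      out c P      ∎)

  -- `feed` from the very start of the order compares both counts on everything before `x`, and `x`
  -- is no out-neighbour of itself.
  last-SNP : ∀ S {x} → Median (S ++ x ∷ []) → SNP x
  last-SNP S {x} m@(p , _) = begin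
    out x L                              ≡⟨ count-↭ (x ⟶?_) p ⟨
    out x (S ++ x ∷ [])                  ≡⟨ count-++ (x ⟶?_) S (x ∷ []) ⟩
    out x S + (⟦ x ⟶? x ⟧ + 0)           ≡⟨ cong (λ k → out x S + (k + 0)) (⟦⟧-no (x ⟶? x) irrefl) ⟩
    out x S + 0                          ≡⟨ +-identityʳ _ ⟩
    out x S                              ≤⟨ feed [] [] S m [] ⟩
    second x S                           ≤⟨ m≤m+n _ _ ⟩
    second x S + second x (x ∷ [])       ≡⟨ count-++ (second? x) S (x ∷ []) ⟨
    second x (S ++ x ∷ [])               ≡⟨ count-↭ (second? x) p ⟩
    second x L                           ∎
    where open ≤-Reasoning

  ¬¬SNP : ∀ {v} → v ∈ L → ¬ ¬ (∃ λ x → x ∈ L × SNP x)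
  ¬¬SNP v∈L none = ¬¬median λ { (M , m) → absurd (initLast M) m }
    where
    absurd : ∀ {M} → InitLast M → ¬ Median M
    absurd []        (p , _) = contradiction (∈-resp-↭ (↭-sym p) v∈L) λ ()
    absurd (S ∷ʳ′ x) m       = none (x , ∈-resp-↭ (proj₁ m) (∈-++⁺ʳ S (here refl)) , last-SNP S m)

  -- Were `x ⟶ y`, exchanging the last two vertices would gain a forward arc. `Unique L` makes them
  -- distinct, hence joined.
  ∷ʳ-last-⟶ : ∀ {S y x} → Unique L → Median (S ++ y ∷ x ∷ []) → y ⟶ x
  ∷ʳ-last-⟶ {S} {y} {x} uniq m@(p , _) with connex {y} {x} y≢x
    where
    y≢x : y ≢ x
    y≢x = All.head (AllPairs.head (Unique-++ʳ S (Unique-resp-↭ (≡.setoid V) (↭⇒↭ₛ (↭-sym p)) uniq)))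
      where
      Unique-++ʳ : ∀ S {W} → Unique (S ++ W) → Unique W
      Unique-++ʳ []      u       = u
      Unique-++ʳ (_ ∷ S) (_ ∷ u) = Unique-++ʳ S u
  ... | inj₁ y⟶x = y⟶x
  ... | inj₂ x⟶y = contradiction
    (subst₂ _≤_ (cong (_+ 0) (⟦⟧-yes (x ⟶? y) x⟶y)) (cong (_+ 0) (⟦⟧-no (y ⟶? x) (asym x⟶y)))
      (median-back S (y ∷ []) m)) λ ()

  -- If the penultimate y fails the property then it has equality in feed, so
  -- that sediment applies; it keeps z and brings it closer to the end.
  two-SNP : ∀ k M z Q {x} → Unique L → length Q ≤ k → x ⟶ z → Median (M ++ z ∷ Q ++ x ∷ []) →
            ∃₂ λ v w → v ≢ w × (v ∈ L × SNP v) × (w ∈ L × SNP w)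
  two-SNP k M z Q {x} uniq Q≤k x⟶z m with initLast Q
  -- Here `z` is the penultimate vertex, so `z ⟶ x`.
  ... | [] = contradiction (∷ʳ-last-⟶ {M} uniq m) (asym x⟶z)
  two-SNP zero M z .(Q ++ y ∷ []) {x} uniq Q≤k x⟶z m | Q ∷ʳ′ y =
    contradiction (≤-trans (≤-reflexive (sym (length-++-sucʳ Q y []))) Q≤k) λ ()
  two-SNP (suc k) M z .(Q ++ y ∷ []) {x} uniq Q≤k x⟶z m | Q ∷ʳ′ y =
    decide (out y L ≤? second y L)
    where
    S = M ++ z ∷ Q
    reassoc : M ++ z ∷ (Q ++ y ∷ []) ++ x ∷ [] ≡ S ++ y ∷ x ∷ []
    reassoc = ≡.trans (cong (λ W → M ++ z ∷ W) (++-assoc Q (y ∷ []) _)) (sym (++-assoc M (z ∷ Q) _))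
    m₁ : Median (S ++ y ∷ x ∷ [])
    m₁ = subst Median reassoc m
    m₂ : Median ((S ++ y ∷ []) ++ x ∷ [])
    m₂ = subst Median (++-∷-snoc S y _) m₁
    S↭L = proj₁ m₁
    y⟶x : y ⟶ x
    y⟶x = ∷ʳ-last-⟶ {S} uniq m₁
    x∈L : x ∈ L
    x∈L = ∈-resp-↭ S↭L (∈-++⁺ʳ S (there (here refl)))
    y∈L : y ∈ L
    y∈L = ∈-resp-↭ S↭L (∈-++⁺ʳ S (here refl))
    -- The path from `y` through `x` reaches `z`, so filtering out the bad vertices never removes
    -- `z`.
    z-nb : NotBad y z
    z-nb z⟶y = z⟶y , lose x∈L (y⟶x , x⟶z)
    step : second y L < out y L → ∃ λ X′ → Median (X′ ++ y ∷ filter (notBad? y) S ++ x ∷ [])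
    -- The strict inequality pays for `x`, which adds at most one to `out y L` and lies outside `S`.
    step lt = sediment [] [] S m₁ [] (≤-pred (begin
      suc (second y S)                       ≤⟨ s≤s (m≤m+n _ _) ⟩
      suc (second y S + second y (y ∷ x ∷ [])) ≡⟨ cong suc (count-++ (second? y) S _) ⟨
      suc (second y (S ++ y ∷ x ∷ []))       ≡⟨ cong suc (count-↭ (second? y) S↭L) ⟩
      suc (second y L)                       ≤⟨ lt ⟩
      out y L                                ≡⟨ count-↭ (y ⟶?_) S↭L ⟨
      out y (S ++ y ∷ x ∷ [])                ≡⟨ count-++ (y ⟶?_) S _ ⟩
      out y S + (⟦ y ⟶? y ⟧ + out y (x ∷ [])) ≡⟨ cong (λ k → out y S + (k + out y (x ∷ []))) (⟦⟧-no (y ⟶? y) irrefl) ⟩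
      out y S + out y (x ∷ [])               ≤⟨ +-monoʳ-≤ (out y S) (count≤length (y ⟶?_) (x ∷ [])) ⟩
      out y S + 1                            ≡⟨ +-comm (out y S) 1 ⟩
      suc (out y S)                          ∎))
      where open ≤-Reasoning
    F = filter (notBad? y)
    filtered : F S ≡ F M ++ z ∷ F Q
    filtered = ≡.trans (filter-++ (notBad? y) M (z ∷ Q)) (cong (F M ++_) (filter-accept (notBad? y) z-nb))
    regroup : ∀ X′ → X′ ++ y ∷ F S ++ x ∷ [] ≡ (X′ ++ y ∷ F M) ++ z ∷ F Q ++ x ∷ []
    regroup X′ = ≡.trans (cong (λ W → X′ ++ y ∷ W ++ x ∷ []) filtered)
      (≡.trans (cong (λ W → X′ ++ y ∷ W) (++-assoc (F M) (z ∷ F Q) _)) (sym (++-assoc X′ (y ∷ F M) _)))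
    -- The drop by one comes from `y`, which has left the segment between `z` and `x`.
    shorter : length (F Q) ≤ k
    shorter = ≤-trans (length-filter (notBad? y) Q)
      (≤-pred (≤-trans (≤-reflexive (≡.trans (cong suc (sym (cong length (++-identityʳ Q))))
        (sym (length-++-sucʳ Q y [])))) Q≤k))
    decide : Dec (SNP y) → _
    decide (yes y-SNP) = x , y , (λ { refl → irrefl y⟶x }) , (x∈L , last-SNP (S ++ y ∷ []) m₂) , (y∈L , y-SNP)
    decide (no ¬y-SNP) =
      let X′ , m′ = step (≰⇒> ¬y-SNP)
      in  two-SNP k (X′ ++ y ∷ F M) z (F Q) uniq shorter x⟶z (subst Median (regroup X′) m′)

  -- The last vertex `x` of a median order has an out-neighbour `z`, which comes earlier in the
  -- order and serves as the starting point for `two-SNP`.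
  ¬¬two-SNP : Unique L → (∀ v → v ∈ L → ∃ λ z → z ∈ L × v ⟶ z) → ∀ {v} → v ∈ L →
              ¬ ¬ (∃₂ λ v w → v ≢ w × (v ∈ L × SNP v) × (w ∈ L × SNP w))
  ¬¬two-SNP uniq no-sink v∈L none = ¬¬median λ { (M , m) → absurd (initLast M) m }
    where
    absurd : ∀ {M} → InitLast M → ¬ Median M
    absurd []        (p , _) = contradiction (∈-resp-↭ (↭-sym p) v∈L) λ ()
    absurd (S ∷ʳ′ x) m@(p , _) with no-sink x (∈-resp-↭ p (∈-++⁺ʳ S (here refl)))
    ... | z , z∈L , x⟶z with ∈-++⁻ S (∈-resp-↭ (↭-sym p) z∈L)
    ...   | inj₂ (here refl) = irrefl x⟶z
    ...   | inj₁ z∈S with ∈-∃++ z∈S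
    ...     | M , Q , refl = none (two-SNP (length Q) M z Q uniq ≤-refl x⟶z
                               (subst Median (++-assoc M (z ∷ Q) _) m))

-- Cardinalities of subsets as counts.

∣subset∣≡count : ∀ {P : U.Pred (Fin n) 0ℓ} (P? : U.Decidable P) → ∣ subset P? ∣ ≡ count P? (allFin n)
∣subset∣≡count {n} P? = along n id
  where
  -- The induction needs an arbitrary enumeration `f`, since the tail of `allFin` is not itself of
  -- that form.
  along : ∀ m (f : Fin m → Fin n) → ∣ tabulate (does ∘ P? ∘ f) ∣ ≡ count P? (List.tabulate f)
  along zero  f = refl
  along (suc m) f with does (P? (f Fin.zero))
  ... | true  = cong suc (along m (f ∘ Fin.suc))
  ... | false = along m (f ∘ Fin.suc)

∈-subset⁺ : ∀ {P : U.Pred (Fin n) 0ℓ} (P? : U.Decidable P) {v} → P v → v Subset.∈ subset P?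
∈-subset⁺ P? {v} Pv = lookup⇒[]= v _ (≡.trans (lookup∘tabulate (does ∘ P?) v) (dec-true (P? v) Pv))

∈-subset⁻ : ∀ {P : U.Pred (Fin n) 0ℓ} (P? : U.Decidable P) {v} → v Subset.∈ subset P? → P v
∈-subset⁻ P? {v} v∈ with P? v | ≡.trans (sym (lookup∘tabulate (does ∘ P?) v)) ([]=⇒lookup v∈)
... | yes Pv | _ = Pv

count-≟ : ∀ (v : Fin n) → count (_≟ v) (allFin n) ≡ 1
count-≟ v = ≡.trans (sym (∣subset∣≡count (_≟ v))) (≡.trans (cong ∣_∣ singleton) (∣⁅x⁆∣≡1 v))
  where
  singleton : subset (_≟ v) ≡ ⁅ v ⁆
  singleton = ⊆-antisym (λ w∈ → Equivalence.from x∈⁅y⁆⇔x≡y (∈-subset⁻ (_≟ v) w∈))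
                        (λ w∈ → ∈-subset⁺ (_≟ v) (x∈⁅y⁆⇒x≡y v w∈))

-- The second neighbourhood property when the star vertices form a module.

module ModuleOfStars (T D : Digraph n) (x y : Fin n) (A B : Subset n) where

  open Digraph T using () renaming (_⟶_ to _⟶ᵀ_; _⟶?_ to _⟶ᵀ?_)
  open Digraph D

  H J : Fin n → Set
  H v = v Subset.∈ A ⊎ v Subset.∈ B
  J v = (v ≡ x ⊎ v ≡ y) ⊎ H v

  -- `from-x` and `to-x` compare every vertex of `J` with the representative `x`: together they give
  -- all of `J` the same out-neighbours outside `J`.
  module _
    (tournament : IsTournament T)
    (x∉H : ¬ H x) (y∉H : ¬ H y)
    (D⇒T : ∀ {u v} → u ⟶ v → u ⟶ᵀ v)
    (outer : ∀ {u v} → ¬ (J u × J v) → u ⟶ᵀ v → u ⟶ v)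
    (inner : ∀ {u v} → H u → H v → u ⟶ᵀ v → u ⟶ v)
    (x⟶y : x ⟶ y)
    (y⟶A : ∀ {a} → a Subset.∈ A → y ⟶ a)
    (B⟶x : ∀ {b} → b Subset.∈ B → b ⟶ x)
    (x⟶̸A : ∀ {a} → a Subset.∈ A → ¬ (x ⟶ a)) (A⟶̸x : ∀ {a} → a Subset.∈ A → ¬ (a ⟶ x))
    (y⟶̸B : ∀ {b} → b Subset.∈ B → ¬ (y ⟶ b)) (B⟶̸y : ∀ {b} → b Subset.∈ B → ¬ (b ⟶ y))
    (from-x : ∀ {u z} → J u → ¬ J z → x ⟶ z → u ⟶ z)
    (to-x : ∀ {u z} → J u → ¬ J z → u ⟶ z → x ⟶ z)
    (A-nonempty : Subset.Nonempty A)
    (no-sink : ∀ v → ¬ Sink _⟶_ v)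
    where

    H? : U.Decidable H
    H? v = (v ∈? A) ⊎-dec (v ∈? B)

    J? : U.Decidable J
    J? v = ((v ≟ x) ⊎-dec (v ≟ y)) ⊎-dec H? v

    irreflᵀ : ∀ {u} → ¬ (u ⟶ᵀ u)
    irreflᵀ = IsTournament.loopless tournament refl

    connexᵀ : ∀ {u v} → u ≢ v → u ⟶ᵀ v ⊎ v ⟶ᵀ u
    connexᵀ {u} {v} u≢v with IsTournament.joined tournament u v u≢v
    ... | inj₁ (u⟶v , _) = inj₁ u⟶v
    ... | inj₂ (v⟶u , _) = inj₂ v⟶u

    asymᵀ : ∀ {u v} → u ⟶ᵀ v → ¬ (v ⟶ᵀ u)
    asymᵀ {u} {v} u⟶v v⟶u with u ≟ v
    ... | yes refl = irreflᵀ u⟶v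
    ... | no u≢v with IsTournament.joined tournament u v u≢v
    ...   | inj₁ (_ , ¬v⟶u) = ¬v⟶u v⟶u
    ...   | inj₂ (_ , ¬u⟶v) = ¬u⟶v u⟶v

    irrefl : ∀ {u} → ¬ (u ⟶ u)
    irrefl = irreflᵀ ∘ D⇒T

    asym : ∀ {u v} → u ⟶ v → ¬ (v ⟶ u)
    asym u⟶v v⟶u = asymᵀ (D⇒T u⟶v) (D⇒T v⟶u)

    outer-connex : ∀ {u v} → ¬ (J u × J v) → u ≢ v → u ⟶ v ⊎ v ⟶ u
    outer-connex ¬J u≢v with connexᵀ u≢v
    ... | inj₁ u⟶v = inj₁ (outer ¬J u⟶v)
    ... | inj₂ v⟶u = inj₂ (outer (λ (Jv , Ju) → ¬J (Ju , Jv)) v⟶u)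

    Jx : J x
    Jx = inj₁ (inj₁ refl)

    Jy : J y
    Jy = inj₁ (inj₂ refl)

    transfer : ∀ {u v z} → J u → J v → ¬ J z → u ⟶ z → v ⟶ z
    transfer Ju Jv ¬Jz u⟶z = from-x Jv ¬Jz (to-x Ju ¬Jz u⟶z)

    -- Every vertex outside `J` is joined to every vertex of `J`, so equal out-neighbourhoods there
    -- force equal in-neighbourhoods.
    transfer⁻ : ∀ {u v z} → J u → J v → ¬ J z → z ⟶ u → z ⟶ v
    transfer⁻ Ju Jv ¬Jz z⟶u with outer-connex (λ (Jz , _) → ¬Jz Jz) (λ { refl → ¬Jz Jv })
    ... | inj₁ z⟶v = z⟶v
    ... | inj₂ v⟶z = contradiction (transfer Jv Ju ¬Jz v⟶z) (asym z⟶u)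

    vs : List (Fin n)
    vs = allFin n

    -- The first and second out-neighbours outside `J`, the latter along paths outside `J`. They are
    -- read off at `x` but are shared by all of `J`.
    Out₁ Out₂ : Fin n → Set
    Out₁ w = ¬ J w × x ⟶ w
    Out₂ w = ¬ J w × w ⟶ x × ∃ λ u → ¬ J u × x ⟶ u × u ⟶ w

    out₁? : U.Decidable Out₁
    out₁? w = ¬? (J? w) ×-dec (x ⟶? w)

    out₂? : U.Decidable Out₂
    out₂? w = ¬? (J? w) ×-dec (w ⟶? x) ×-dec any? λ u → ¬? (J? u) ×-dec (x ⟶? u) ×-dec (u ⟶? w)

    SNP : Fin n → Set
    SNP = SecondNeighborhoodProperty D

    from-counts : ∀ v → count (v ⟶?_) vs ≤ count (atDistance2? D v) vs → SNP v
    from-counts v = subst₂ _≤_ (sym (∣subset∣≡count (v ⟶?_))) (sym (∣subset∣≡count (atDistance2? D v)))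

    module _ (outside : count out₁? vs ≤ count out₂? vs) where

      -- Both neighbourhoods split at `J`: `P` covers the out-neighbours inside, `Q` supplies second
      -- ones inside, and `outside` settles the common rest.
      module-SNP : ∀ {v} {P Q : U.Pred (Fin n) 0ℓ} (P? : U.Decidable P) (Q? : U.Decidable Q) → J v →
                   (∀ {w} → J w → v ⟶ w → P w) → (∀ {w} → Q w → J w × AtDistance2 D v w) →
                   count P? vs ≤ count Q? vs → SNP v
      module-SNP {v} {P} {Q} P? Q? Jv P-out Q-second P≤Q = from-counts v (begin
        count (v ⟶?_) vs                   ≤⟨ count-⊆-⊎ (v ⟶?_) P? out₁? split vs ⟩
        count P? vs + count out₁? vs       ≤⟨ +-mono-≤ P≤Q outside ⟩
        count Q? vs + count out₂? vs       ≤⟨ count-disjoint-⊎ (atDistance2? D v) Q? out₂?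
                                                (proj₂ ∘ Q-second) far (λ q (¬Jw , _) → ¬Jw (proj₁ (Q-second q))) vs ⟩
        count (atDistance2? D v) vs        ∎)
        where
        open ≤-Reasoning
        split : ∀ {w} → v ⟶ w → P w ⊎ Out₁ w
        split {w} v⟶w with J? w
        ... | yes Jw = inj₁ (P-out Jw v⟶w)
        ... | no ¬Jw = inj₂ (¬Jw , transfer Jv Jx ¬Jw v⟶w)
        far : ∀ {w} → Out₂ w → AtDistance2 D v w
        far (¬Jw , w⟶x , u , ¬Ju , x⟶u , u⟶w) =
          (λ { refl → ¬Jw Jv }) , asym (transfer⁻ Jx Jv ¬Jw w⟶x) , u , transfer Jx Jv ¬Ju x⟶u , u⟶w

      -- Inside `J` the only out-neighbour of `x` is `y`, through which every leaf in `A` is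
      -- reached; one leaf is enough.
      x-SNP : SNP x
      x-SNP = module-SNP (_≟ y) (_∈? A) Jx x-out x-second
        (≤-trans (≤-reflexive (≡.trans (count-≟ y) (sym (count-≟ a))))
          (count-mono (_≟ a) (_∈? A) vs (λ _ → λ { refl → a∈A })))
        where
        a = proj₁ A-nonempty
        a∈A = proj₂ A-nonempty
        x-out : ∀ {w} → J w → x ⟶ w → w ≡ y
        x-out (inj₁ (inj₁ refl)) x⟶x = contradiction x⟶x irrefl
        x-out (inj₁ (inj₂ w≡y))  _   = w≡y
        x-out (inj₂ (inj₁ w∈A))  x⟶w = contradiction x⟶w (x⟶̸A w∈A)
        x-out (inj₂ (inj₂ w∈B))  x⟶w = contradiction x⟶w (asym (B⟶x w∈B))
        x-second : ∀ {w} → w Subset.∈ A → J w × AtDistance2 D x w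
        x-second w∈A = inj₂ (inj₁ w∈A) , (λ { refl → x∉H (inj₁ w∈A) }) , x⟶̸A w∈A , y , x⟶y , y⟶A w∈A

      module TH = TournamentOn _⟶ᵀ?_ irreflᵀ asymᵀ connexᵀ (filter H? vs)

      -- A leaf in `A` dominates neither centre, so the leaves decide. A leaf in `B` gains the
      -- out-neighbour `x` but also, through it, the second out-neighbour `y`.
      H-SNP : ∀ {p} → H p → TH.SNP p → SNP p
      H-SNP {p} Hp p-SNP = by-side Hp
        where
        P? = λ w → H? w ×-dec (p ⟶ᵀ? w)
        Q? = λ w → H? w ×-dec TH.second? p w

        P≤Q : count P? vs ≤ count Q? vs
        P≤Q = subst₂ _≤_ (count-filter (p ⟶ᵀ?_) H? vs) (count-filter (TH.second? p) H? vs) p-SNP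

        Q-second : ∀ {w} → H w × TH.Second p w → J w × AtDistance2 D p w
        Q-second (Hw , w⟶p , path) with find path
        ... | u , u∈ , p⟶u , u⟶w with ∈-filter⁻ H? {xs = vs} u∈
        ...   | _ , Hu = inj₂ Hw , (λ { refl → irreflᵀ w⟶p }) , asym (inner Hw Hp w⟶p) ,
                         u , inner Hp Hu p⟶u , inner Hu Hw u⟶w

        by-side : H p → SNP p
        by-side (inj₁ p∈A) = module-SNP P? Q? (inj₂ Hp) p-out Q-second P≤Q
          where
          p-out : ∀ {w} → J w → p ⟶ w → H w × p ⟶ᵀ w
          p-out (inj₁ (inj₁ refl)) p⟶x = contradiction p⟶x (A⟶̸x p∈A)
          p-out (inj₁ (inj₂ refl)) p⟶y = contradiction p⟶y (asym (y⟶A p∈A))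
          p-out (inj₂ Hw)          p⟶w = Hw , D⇒T p⟶w
        by-side (inj₂ p∈B) =
          module-SNP (λ w → (w ≟ x) ⊎-dec P? w) (λ w → (w ≟ y) ⊎-dec Q? w) (inj₂ Hp) p-out Q-second′ (begin
            count (λ w → (w ≟ x) ⊎-dec P? w) vs    ≤⟨ count-⊆-⊎ _ (_≟ x) P? id vs ⟩
            count (_≟ x) vs + count P? vs          ≤⟨ +-mono-≤ (≤-reflexive (≡.trans (count-≟ x) (sym (count-≟ y)))) P≤Q ⟩
            count (_≟ y) vs + count Q? vs          ≤⟨ count-disjoint-⊎ _ (_≟ y) Q? inj₁ inj₂
                                                        (λ { refl (Hy , _) → y∉H Hy }) vs ⟩
            count (λ w → (w ≟ y) ⊎-dec Q? w) vs    ∎)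
          where
          open ≤-Reasoning
          p-out : ∀ {w} → J w → p ⟶ w → w ≡ x ⊎ (H w × p ⟶ᵀ w)
          p-out (inj₁ (inj₁ w≡x))  _   = inj₁ w≡x
          p-out (inj₁ (inj₂ refl)) p⟶y = contradiction p⟶y (B⟶̸y p∈B)
          p-out (inj₂ Hw)          p⟶w = inj₂ (Hw , D⇒T p⟶w)
          Q-second′ : ∀ {w} → w ≡ y ⊎ (H w × TH.Second p w) → J w × AtDistance2 D p w
          Q-second′ (inj₁ refl) = Jy , (λ { refl → y∉H Hp }) , B⟶̸y p∈B , x , B⟶x p∈B , x⟶y
          Q-second′ (inj₂ q)    = Q-second q

      two-in-module : ¬ ¬ (∃₂ λ v w → v ≢ w × SNP v × SNP w)
      two-in-module none = TH.¬¬SNP (∈-filter⁺ H? (∈-allFin _) (inj₁ (proj₂ A-nonempty)))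
        λ (p , p∈ , p-SNP) → let Hp = proj₂ (∈-filter⁻ H? {xs = vs} p∈) in
          none (x , p , (λ { refl → x∉H Hp }) , x-SNP , H-SNP Hp p-SNP)

    -- D with the module J made transitive, hence a tournament: no vertex of J
    -- gains a second out-neighbour inside J.
    infix 4 _⇒_ _⇒?_
    _⇒_ : Rel (Fin n) 0ℓ
    u ⇒ v = (J u × J v) × u Fin.< v ⊎ ¬ (J u × J v) × u ⟶ v

    _⇒?_ : Decidable _⇒_
    u ⇒? v = (J? u ×-dec J? v) ×-dec (u Fin.<? v) ⊎-dec ¬? (J? u ×-dec J? v) ×-dec (u ⟶? v)

    ⇒-irrefl : ∀ {u} → ¬ (u ⇒ u)
    ⇒-irrefl (inj₁ (_ , u<u)) = Fin.<-irrefl refl u<u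
    ⇒-irrefl (inj₂ (_ , u⟶u)) = irrefl u⟶u

    ⇒-asym : ∀ {u v} → u ⇒ v → ¬ (v ⇒ u)
    ⇒-asym (inj₁ (_ , u<v))         (inj₁ (_ , v<u))         = Fin.<-asym u<v v<u
    ⇒-asym (inj₁ ((Ju , Jv) , _))   (inj₂ (¬J , _))          = ¬J (Jv , Ju)
    ⇒-asym (inj₂ (¬J , _))          (inj₁ ((Jv , Ju) , _))   = ¬J (Ju , Jv)
    ⇒-asym (inj₂ (_ , u⟶v))         (inj₂ (_ , v⟶u))         = asym u⟶v v⟶u

    ⇒-connex : ∀ {u v} → u ≢ v → u ⇒ v ⊎ v ⇒ u
    ⇒-connex {u} {v} u≢v with J? u ×-dec J? v
    ... | yes (Ju , Jv) with Fin.<-cmp u v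
    ...   | tri< u<v _ _ = inj₁ (inj₁ ((Ju , Jv) , u<v))
    ...   | tri≈ _ u≡v _ = contradiction u≡v u≢v
    ...   | tri> _ _ v<u = inj₂ (inj₁ ((Jv , Ju) , v<u))
    ⇒-connex {u} {v} u≢v | no ¬J with outer-connex ¬J u≢v
    ...   | inj₁ u⟶v = inj₁ (inj₂ (¬J , u⟶v))
    ...   | inj₂ v⟶u = inj₂ (inj₂ ((λ (Jv , Ju) → ¬J (Ju , Jv)) , v⟶u))

    ⇒⇒⟶ : ∀ {u v} → ¬ (J u × J v) → u ⇒ v → u ⟶ v
    ⇒⇒⟶ ¬J (inj₁ (Juv , _)) = contradiction Juv ¬J
    ⇒⇒⟶ ¬J (inj₂ (_ , u⟶v)) = u⟶v

    module T⇒ = TournamentOn _⇒?_ ⇒-irrefl ⇒-asym ⇒-connex vs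

    -- In the modified tournament a second out-neighbour of `v` lies outside `J`, as does the middle
    -- vertex: inside `J` the order is transitive, a path that leaves `J` cannot return in two
    -- steps, and one that leaves by its second arc ends at an out-neighbour of `v`.
    module-SNP⇒outside : ∀ {v} → J v → T⇒.SNP v → count out₁? vs ≤ count out₂? vs
    module-SNP⇒outside {v} Jv v-SNP = begin
      count out₁? vs           ≤⟨ count-mono out₁? (v ⇒?_) vs (λ _ (¬Jw , x⟶w) →
                                    inj₂ ((λ (_ , Jw) → ¬Jw Jw) , transfer Jx Jv ¬Jw x⟶w)) ⟩
      count (v ⇒?_) vs         ≤⟨ v-SNP ⟩
      count (T⇒.second? v) vs  ≤⟨ count-mono (T⇒.second? v) out₂? vs (λ _ → second-outside) ⟩
      count out₂? vs           ∎
      where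
      open ≤-Reasoning
      second-outside : ∀ {w} → T⇒.Second v w → Out₂ w
      second-outside {w} (w⇒v , path) with find path
      ... | u , _ , v⇒u , u⇒w with J? w | J? u
      ...   | yes Jw | yes Ju = contradiction (Fin.<-trans (lt v⇒u Jv Ju) (lt u⇒w Ju Jw)) (Fin.<-asym (lt w⇒v Jw Jv))
        where
        lt : ∀ {s t} → s ⇒ t → J s → J t → s Fin.< t
        lt (inj₁ (_ , s<t)) _  _  = s<t
        lt (inj₂ (¬J , _))  Js Jt = contradiction (Js , Jt) ¬J
      ...   | yes Jw | no ¬Ju = contradiction (transfer Jv Jw ¬Ju (⇒⇒⟶ (¬Ju ∘ proj₂) v⇒u))
                                              (asym (⇒⇒⟶ (¬Ju ∘ proj₁) u⇒w))
      ...   | no ¬Jw | yes Ju = contradiction (transfer Ju Jv ¬Jw (⇒⇒⟶ (¬Jw ∘ proj₂) u⇒w))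
                                              (asym (⇒⇒⟶ (¬Jw ∘ proj₁) w⇒v))
      ...   | no ¬Jw | no ¬Ju = ¬Jw , transfer⁻ Jv Jx ¬Jw (⇒⇒⟶ (¬Jw ∘ proj₁) w⇒v) ,
                                u , ¬Ju , transfer Jv Jx ¬Ju (⇒⇒⟶ (¬Ju ∘ proj₂) v⇒u) , ⇒⇒⟶ (¬Jw ∘ proj₂) u⇒w

    -- Arcs at `v` are those of `D`. A path to a second out-neighbour uses no arc inside `J`, for
    -- `v` would dominate both its ends or neither.
    outside-SNP : ∀ {v} → ¬ J v → T⇒.SNP v → SNP v
    outside-SNP {v} ¬Jv v-SNP = from-counts v (begin
      count (v ⟶?_) vs             ≤⟨ count-mono (v ⟶?_) (v ⇒?_) vs (λ _ v⟶w → inj₂ (¬Jv ∘ proj₁ , v⟶w)) ⟩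
      count (v ⇒?_) vs             ≤⟨ v-SNP ⟩
      count (T⇒.second? v) vs      ≤⟨ count-mono (T⇒.second? v) (atDistance2? D v) vs (λ _ → second-D) ⟩
      count (atDistance2? D v) vs  ∎)
      where
      open ≤-Reasoning
      second-D : ∀ {w} → T⇒.Second v w → AtDistance2 D v w
      second-D {w} (w⇒v , path) with find path
      ... | u , _ , v⇒u , u⇒w =
        (λ { refl → ⇒-irrefl w⇒v }) , asym w⟶v , u , v⟶u , ⇒⇒⟶ ¬Juw u⇒w
        where
        w⟶v : w ⟶ v
        w⟶v = ⇒⇒⟶ (¬Jv ∘ proj₂) w⇒v
        v⟶u : v ⟶ u
        v⟶u = ⇒⇒⟶ (¬Jv ∘ proj₁) v⇒u
        ¬Juw : ¬ (J u × J w)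
        ¬Juw (Ju , Jw) = asym w⟶v (transfer⁻ Ju Jw ¬Jv v⟶u)

    two-SNP : ∃₂ λ v w → v ≢ w × SNP v × SNP w
    two-SNP = decidable-stable conclusion? λ none → ¬¬two none
      where
      snp? : U.Decidable SNP
      snp? v = d⁺ D v ≤? d⁺⁺ D v
      conclusion? : Dec (∃₂ λ v w → v ≢ w × SNP v × SNP w)
      conclusion? = any? λ v → any? λ w → ¬? (v ≟ w) ×-dec snp? v ×-dec snp? w
      ¬¬two : ¬ ¬ (∃₂ λ v w → v ≢ w × SNP v × SNP w)
      ¬¬two none with any? out₁?
      -- Without out-neighbours outside `J` the left side of `outside` is zero.
      ... | no ¬out = two-in-module
        (≤-trans (≤-reflexive (count-none out₁? vs λ w o → ¬out (w , o))) z≤n) none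
      ... | yes (z , ¬Jz , x⟶z) = T⇒.¬¬two-SNP (allFin⁺ n) ⇒-no-sink (∈-allFin x)
        λ (v , w , v≢w , (_ , v-SNP) , (_ , w-SNP)) → finish v w v≢w v-SNP w-SNP (J? v) (J? w)
        where
        -- Vertices of `J` all dominate `z`; the others keep the out-neighbours they have in `D`.
        ⇒-no-sink : ∀ v → _ → ∃ λ u → _ × v ⇒ u
        ⇒-no-sink v _ with J? v
        ... | yes Jv = z , ∈-allFin z , inj₂ (¬Jz ∘ proj₂ , transfer Jx Jv ¬Jz x⟶z)
        ... | no ¬Jv with any? (v ⟶?_)
        ...   | yes (u , v⟶u) = u , ∈-allFin u , inj₂ (¬Jv ∘ proj₁ , v⟶u)
        ...   | no ¬out       = contradiction (λ u v⟶u → ¬out (u , v⟶u)) (no-sink v)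
        finish : ∀ v w → v ≢ w → T⇒.SNP v → T⇒.SNP w → Dec (J v) → ¬ Dec (J w)
        finish v w v≢w v-SNP w-SNP (yes Jv) _        = two-in-module (module-SNP⇒outside Jv v-SNP) none
        finish v w v≢w v-SNP w-SNP (no _)   (yes Jw) = two-in-module (module-SNP⇒outside Jw w-SNP) none
        finish v w v≢w v-SNP w-SNP (no ¬Jv) (no ¬Jw) = none (v , w , v≢w , outside-SNP ¬Jv v-SNP , outside-SNP ¬Jw w-SNP)

-- Missing edges and the arcs of the dependency digraph.

⁅⁆∪⁅⁆-injective : ∀ {u v s t : Fin n} → u ≢ v → ⁅ u ⁆ Subset.∪ ⁅ v ⁆ ≡ ⁅ s ⁆ Subset.∪ ⁅ t ⁆ →
                  (u ≡ s × v ≡ t) ⊎ (u ≡ t × v ≡ s)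
⁅⁆∪⁅⁆-injective {u = u} {v} {s} {t} u≢v eq
  with among (x∈p∪q⁺ (inj₁ (x∈⁅x⁆ u))) | among (x∈p∪q⁺ {p = ⁅ u ⁆} (inj₂ (x∈⁅x⁆ v)))
  where
  among : ∀ {w} → w Subset.∈ ⁅ u ⁆ Subset.∪ ⁅ v ⁆ → w ≡ s ⊎ w ≡ t
  among {w} w∈ = [ inj₁ ∘ x∈⁅y⁆⇒x≡y s , inj₂ ∘ x∈⁅y⁆⇒x≡y t ]′ (x∈p∪q⁻ _ _ (subst (w Subset.∈_) eq w∈))
... | inj₁ refl | inj₁ refl = contradiction refl u≢v
... | inj₁ u≡s  | inj₂ v≡t  = inj₁ (u≡s , v≡t)
... | inj₂ u≡t  | inj₁ v≡s  = inj₂ (u≡t , v≡s)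
... | inj₂ refl | inj₂ refl = contradiction refl u≢v

-- `D` is a parameter tied to the stars by hypotheses on the union of their edges, so the stars can
-- be exchanged while `D` stays the same.
module TwoStars (T D : Digraph n) (S₁ S₂ : Star n) where

  open Digraph T using () renaming (_⟶_ to _⟶ᵀ_)
  open Digraph D
  open Star S₁ using () renaming (center to x; leaves to A; Edge to Edge₁; edge? to edge₁?)
  open Star S₂ using () renaming (center to y; leaves to B; Edge to Edge₂; edge? to edge₂?)
  open ModuleOfStars T D x y A B using (H; J)

  module _
    (tournament : IsTournament T) (disjoint : Disjoint S₁ S₂)
    (D⇒T : ∀ {u v} → u ⟶ v → u ⟶ᵀ v)
    (D⇒¬Edge : ∀ {u v} → u ⟶ v → ¬ (Edge₁ u v ⊎ Edge₂ u v))
    (T⇒D : ∀ {u v} → u ⟶ᵀ v → ¬ (Edge₁ u v ⊎ Edge₂ u v) → u ⟶ v)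
    (no-source : ∀ e → ¬ Source (LosesTo D) e)
    (no-sink-Δ : ∀ e → ¬ Sink (LosesTo D) e)
    (no-sink : ∀ v → ¬ Sink _⟶_ v)
    (x⟶ᵀy : x ⟶ᵀ y)
    where

    private
      apart : ∀ {u v} → u ≡ x ⊎ u Subset.∈ A → v ≡ y ⊎ v Subset.∈ B → u ≢ v
      apart {u} u∈₁ u∈₂ refl = disjoint (u , x∈p∩q⁺ (vertex S₁ u∈₁ , vertex S₂ u∈₂))
        where
        vertex : ∀ S {w} → w ≡ Star.center S ⊎ w Subset.∈ Star.leaves S → w Subset.∈ Star.vertices S
        vertex S (inj₁ refl) = x∈p∪q⁺ (inj₁ (x∈⁅x⁆ _))
        vertex S (inj₂ w∈)   = x∈p∪q⁺ {p = ⁅ Star.center S ⁆} (inj₂ w∈)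

      x∉H : ¬ H x
      x∉H (inj₁ x∈A) = Star.center∉leaves S₁ x∈A
      x∉H (inj₂ x∈B) = apart (inj₁ refl) (inj₂ x∈B) refl

      y∉H : ¬ H y
      y∉H (inj₁ y∈A) = apart (inj₂ y∈A) (inj₁ refl) refl
      y∉H (inj₂ y∈B) = Star.center∉leaves S₂ y∈B

      edge-sym : ∀ {u v} → Edge₁ u v ⊎ Edge₂ u v → Edge₁ v u ⊎ Edge₂ v u
      edge-sym (inj₁ (inj₁ e)) = inj₁ (inj₂ e)
      edge-sym (inj₁ (inj₂ e)) = inj₁ (inj₁ e)
      edge-sym (inj₂ (inj₁ e)) = inj₂ (inj₂ e)
      edge-sym (inj₂ (inj₂ e)) = inj₂ (inj₁ e)

      edge⇒J : ∀ {u v} → Edge₁ u v ⊎ Edge₂ u v → J u × J v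
      edge⇒J (inj₁ (inj₁ (u∈A , refl))) = inj₂ (inj₁ u∈A) , inj₁ (inj₁ refl)
      edge⇒J (inj₁ (inj₂ (v∈A , refl))) = inj₁ (inj₁ refl) , inj₂ (inj₁ v∈A)
      edge⇒J (inj₂ (inj₁ (u∈B , refl))) = inj₂ (inj₂ u∈B) , inj₁ (inj₂ refl)
      edge⇒J (inj₂ (inj₂ (v∈B , refl))) = inj₁ (inj₂ refl) , inj₂ (inj₂ v∈B)

      edge⇒¬H : ∀ {u v} → Edge₁ u v ⊎ Edge₂ u v → ¬ (H u × H v)
      edge⇒¬H (inj₁ (inj₁ (_ , refl))) = x∉H ∘ proj₂
      edge⇒¬H (inj₁ (inj₂ (_ , refl))) = x∉H ∘ proj₁
      edge⇒¬H (inj₂ (inj₁ (_ , refl))) = y∉H ∘ proj₂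
      edge⇒¬H (inj₂ (inj₂ (_ , refl))) = y∉H ∘ proj₁

      irrefl : ∀ {u} → ¬ (u ⟶ u)
      irrefl = IsTournament.loopless tournament refl ∘ D⇒T

      adjacent : ∀ {u v} → u ≢ v → ¬ (Edge₁ u v ⊎ Edge₂ u v) → u ⟶ v ⊎ v ⟶ u
      adjacent {u} {v} u≢v ¬e with IsTournament.joined tournament u v u≢v
      ... | inj₁ (u⟶v , _) = inj₁ (T⇒D u⟶v ¬e)
      ... | inj₂ (v⟶u , _) = inj₂ (T⇒D v⟶u (¬e ∘ edge-sym))

      x⟶y : x ⟶ y
      x⟶y = T⇒D x⟶ᵀy λ
        { (inj₁ (inj₁ (x∈A , _))) → x∉H (inj₁ x∈A)
        ; (inj₁ (inj₂ (y∈A , _))) → y∉H (inj₁ y∈A)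
        ; (inj₂ (inj₁ (x∈B , _))) → x∉H (inj₂ x∈B)
        ; (inj₂ (inj₂ (y∈B , _))) → y∉H (inj₂ y∈B) }

      y⟶̸x : ¬ (y ⟶ x)
      y⟶̸x y⟶x with IsTournament.joined tournament x y (apart (inj₁ refl) (inj₁ refl))
      ... | inj₁ (_ , ¬y⟶x) = ¬y⟶x (D⇒T y⟶x)
      ... | inj₂ (_ , ¬x⟶y) = ¬x⟶y x⟶ᵀy

      missing? : Decidable (Missing D)
      missing? u v = ¬? (u ≟ v) ×-dec ¬? (u ⟶? v) ×-dec ¬? (v ⟶? u)

      edge⇒Missing : ∀ {u v} → u ≢ v → Edge₁ u v ⊎ Edge₂ u v → Missing D u v
      edge⇒Missing u≢v e = u≢v , (λ u⟶v → D⇒¬Edge u⟶v e) , λ v⟶u → D⇒¬Edge v⟶u (edge-sym e)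

      Missing⇒edge : ∀ {u v} → Missing D u v → Edge₁ u v ⊎ Edge₂ u v
      Missing⇒edge {u} {v} (u≢v , ¬u⟶v , ¬v⟶u) =
        decidable-stable (edge₁? u v ⊎-dec edge₂? u v) λ ¬e → [ ¬u⟶v , ¬v⟶u ]′ (adjacent u≢v ¬e)

      -- The witness inside a missing edge is irrelevant; it is recovered because `Missing` is
      -- decidable.
      value⇒edge : ∀ (e : MissingEdge D) {u v} → value e ≡ ⁅ u ⁆ Subset.∪ ⁅ v ⁆ → Edge₁ u v ⊎ Edge₂ u v
      value⇒edge (._ , [ witness ]) {u} {v} refl = Missing⇒edge (recompute (missing? u v) (transport witness))
        where
        transport : (∃₂ λ s t → ⁅ u ⁆ Subset.∪ ⁅ v ⁆ ≡ ⁅ s ⁆ Subset.∪ ⁅ t ⁆ × Missing D s t) → Missing D u v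
        transport (_ , _ , eq , m@(s≢t , ¬s⟶t , ¬t⟶s)) with ⁅⁆∪⁅⁆-injective s≢t (sym eq)
        ... | inj₁ (refl , refl) = m
        ... | inj₂ (refl , refl) = s≢t ∘ sym , ¬t⟶s , ¬s⟶t

      -- Excludes paths of length two only; a direct arc is not mentioned.
      Unreachable : Fin n → Fin n → Set
      Unreachable u v = ∀ {z} → u ⟶ z → ¬ (z ⟶ v)

      unreachable : ∀ {u v} → u ≢ v → v Subset.∉ N⁺ D u Subset.∪ N⁺⁺ D u → Unreachable u v
      unreachable {u} {v} u≢v v∉ {z} u⟶z z⟶v with u ⟶? v
      ... | yes u⟶v = v∉ (x∈p∪q⁺ (inj₁ (∈-subset⁺ (u ⟶?_) u⟶v)))
      ... | no ¬u⟶v = v∉ (x∈p∪q⁺ {p = N⁺ D u} (inj₂ (∈-subset⁺ (atDistance2? D u) (u≢v , ¬u⟶v , z , u⟶z , z⟶v))))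

      -- The parts of "ax loses to by" and "by loses to ax" that the proof uses.
      AX-loses BY-loses : Fin n → Fin n → Set
      AX-loses a b = Unreachable a y × Unreachable x b
      BY-loses b a = b ⟶ x × y ⟶ a × Unreachable b a × Unreachable y x

      Losing : Subset n → Subset n → Set
      Losing e e′ = ∃₂ λ a b → a Subset.∈ A × b Subset.∈ B ×
        ((e ≡ ⁅ a ⁆ Subset.∪ ⁅ x ⁆ × e′ ≡ ⁅ b ⁆ Subset.∪ ⁅ y ⁆ × AX-loses a b) ⊎
         (e ≡ ⁅ b ⁆ Subset.∪ ⁅ y ⁆ × e′ ≡ ⁅ a ⁆ Subset.∪ ⁅ x ⁆ × BY-loses b a))

      -- Within one star a loss would need a loop at the centre or an arc along a star edge. Across
      -- the stars, `x ⟶ y` leaves a single naming of the endpoints for each direction.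
      losing : ∀ e e′ → LosesTo D e e′ → Losing (value e) (value e′)
      losing e e′ (x₁ , y₁ , x₂ , y₂ , e≡ , e′≡ , x₁⟶x₂ , y₂∉ , y₁⟶y₂ , x₂∉) =
        by-center (value⇒edge e e≡) (value⇒edge e′ e′≡)
        where
        leaf-first : ∀ {x₁ y₁ x₂ y₂} → value e ≡ ⁅ x₁ ⁆ Subset.∪ ⁅ y₁ ⁆ → value e′ ≡ ⁅ x₂ ⁆ Subset.∪ ⁅ y₂ ⁆ →
                     x₁ ⟶ x₂ → y₂ Subset.∉ N⁺ D x₁ Subset.∪ N⁺⁺ D x₁ →
                     y₁ ⟶ y₂ → x₂ Subset.∉ N⁺ D y₁ Subset.∪ N⁺⁺ D y₁ →
                     (x₁ Subset.∈ A × y₁ ≡ x) ⊎ (x₁ Subset.∈ B × y₁ ≡ y) → Edge₁ x₂ y₂ ⊎ Edge₂ x₂ y₂ →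
                     Losing (value e) (value e′)
        leaf-first e≡ e′≡ x₁⟶x₂ y₂∉ y₁⟶y₂ x₂∉ (inj₁ (x₁∈A , refl)) (inj₁ (inj₁ (_ , refl))) =
          contradiction y₁⟶y₂ irrefl
        leaf-first e≡ e′≡ x₁⟶x₂ y₂∉ y₁⟶y₂ x₂∉ (inj₁ (x₁∈A , refl)) (inj₁ (inj₂ (y₂∈A , refl))) =
          contradiction (inj₁ (inj₂ (y₂∈A , refl))) (D⇒¬Edge y₁⟶y₂)
        leaf-first e≡ e′≡ x₁⟶x₂ y₂∉ y₁⟶y₂ x₂∉ (inj₁ (x₁∈A , refl)) (inj₂ (inj₁ (x₂∈B , refl))) =
          _ , _ , x₁∈A , x₂∈B , inj₁ (e≡ , e′≡ ,
            unreachable (apart (inj₂ x₁∈A) (inj₁ refl)) y₂∉ , unreachable (apart (inj₁ refl) (inj₂ x₂∈B)) x₂∉)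
        leaf-first e≡ e′≡ x₁⟶x₂ y₂∉ y₁⟶y₂ x₂∉ (inj₁ (x₁∈A , refl)) (inj₂ (inj₂ (y₂∈B , refl))) =
          contradiction (x∈p∪q⁺ (inj₁ (∈-subset⁺ (x ⟶?_) x⟶y))) x₂∉
        leaf-first e≡ e′≡ x₁⟶x₂ y₂∉ y₁⟶y₂ x₂∉ (inj₂ (x₁∈B , refl)) (inj₁ (inj₁ (_ , refl))) =
          contradiction y₁⟶y₂ y⟶̸x
        leaf-first e≡ e′≡ x₁⟶x₂ y₂∉ y₁⟶y₂ x₂∉ (inj₂ (x₁∈B , refl)) (inj₁ (inj₂ (y₂∈A , refl))) =
          _ , _ , y₂∈A , x₁∈B , inj₂ (e≡ , ≡.trans e′≡ (∪-comm _ _) , x₁⟶x₂ , y₁⟶y₂ ,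
            unreachable (apart (inj₂ y₂∈A) (inj₂ x₁∈B) ∘ sym) y₂∉ , unreachable (apart (inj₁ refl) (inj₁ refl) ∘ sym) x₂∉)
        leaf-first e≡ e′≡ x₁⟶x₂ y₂∉ y₁⟶y₂ x₂∉ (inj₂ (x₁∈B , refl)) (inj₂ (inj₁ (_ , refl))) =
          contradiction y₁⟶y₂ irrefl
        leaf-first e≡ e′≡ x₁⟶x₂ y₂∉ y₁⟶y₂ x₂∉ (inj₂ (x₁∈B , refl)) (inj₂ (inj₂ (y₂∈B , refl))) =
          contradiction (inj₂ (inj₂ (y₂∈B , refl))) (D⇒¬Edge y₁⟶y₂)

        by-center : Edge₁ x₁ y₁ ⊎ Edge₂ x₁ y₁ → Edge₁ x₂ y₂ ⊎ Edge₂ x₂ y₂ → Losing (value e) (value e′)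
        by-center (inj₁ (inj₁ l)) = leaf-first e≡ e′≡ x₁⟶x₂ y₂∉ y₁⟶y₂ x₂∉ (inj₁ l)
        by-center (inj₂ (inj₁ l)) = leaf-first e≡ e′≡ x₁⟶x₂ y₂∉ y₁⟶y₂ x₂∉ (inj₂ l)
        -- Exchanging the names of the endpoints in both edges preserves the relation, so the leaf
        -- of `e` may be named first.
        by-center (inj₁ (inj₂ l)) = leaf-first (≡.trans e≡ (∪-comm _ _)) (≡.trans e′≡ (∪-comm _ _))
                                      y₁⟶y₂ x₂∉ x₁⟶x₂ y₂∉ (inj₁ l) ∘ edge-sym
        by-center (inj₂ (inj₂ l)) = leaf-first (≡.trans e≡ (∪-comm _ _)) (≡.trans e′≡ (∪-comm _ _))
                                      y₁⟶y₂ x₂∉ x₁⟶x₂ y₂∉ (inj₂ l) ∘ edge-sym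

      ax : ∀ {a} → a Subset.∈ A → MissingEdge D
      ax {a} a∈A = ⁅ a ⁆ Subset.∪ ⁅ x ⁆ ,
        [ a , x , refl , edge⇒Missing (λ { refl → x∉H (inj₁ a∈A) }) (inj₁ (inj₁ (a∈A , refl))) ]

      by : ∀ {b} → b Subset.∈ B → MissingEdge D
      by {b} b∈B = ⁅ b ⁆ Subset.∪ ⁅ y ⁆ ,
        [ b , y , refl , edge⇒Missing (λ { refl → y∉H (inj₂ b∈B) }) (inj₂ (inj₁ (b∈B , refl))) ]

      ax-injective : ∀ {a a′} → a Subset.∈ A → ⁅ a ⁆ Subset.∪ ⁅ x ⁆ ≡ ⁅ a′ ⁆ Subset.∪ ⁅ x ⁆ → a ≡ a′
      ax-injective a∈A eq with ⁅⁆∪⁅⁆-injective (λ { refl → x∉H (inj₁ a∈A) }) eq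
      ... | inj₁ (a≡a′ , _) = a≡a′
      ... | inj₂ (refl , _) = contradiction (inj₁ a∈A) x∉H

      by-injective : ∀ {b b′} → b Subset.∈ B → ⁅ b ⁆ Subset.∪ ⁅ y ⁆ ≡ ⁅ b′ ⁆ Subset.∪ ⁅ y ⁆ → b ≡ b′
      by-injective b∈B eq with ⁅⁆∪⁅⁆-injective (λ { refl → y∉H (inj₂ b∈B) }) eq
      ... | inj₁ (b≡b′ , _) = b≡b′
      ... | inj₂ (refl , _) = contradiction (inj₂ b∈B) y∉H

      ax≢by : ∀ {a b} → a Subset.∈ A → b Subset.∈ B → ⁅ a ⁆ Subset.∪ ⁅ x ⁆ ≢ ⁅ b ⁆ Subset.∪ ⁅ y ⁆
      ax≢by a∈A b∈B eq with ⁅⁆∪⁅⁆-injective (λ { refl → x∉H (inj₁ a∈A) }) eq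
      ... | inj₁ (refl , _) = apart (inj₂ a∈A) (inj₂ b∈B) refl
      ... | inj₂ (refl , _) = y∉H (inj₁ a∈A)

      -- The absence of sources and sinks yields a neighbour in the dependency digraph only under
      -- double negation; a decidable goal `R` allows it to be used all the same.
      module _ {R : Set} (R? : Dec R) where

        ax-loses : ∀ {a} → a Subset.∈ A → (∀ {b} → b Subset.∈ B → AX-loses a b → R) → R
        ax-loses a∈A f = decidable-stable R? λ ¬R → no-sink-Δ (ax a∈A) λ e l → ¬R (from e (losing (ax a∈A) e l))
          where
          from : ∀ e → Losing _ (value e) → R
          from e (_ , _ , _ , b∈B , inj₁ (eq , _ , l)) with refl ← ax-injective a∈A eq = f b∈B l
          from e (_ , _ , _ , b∈B , inj₂ (eq , _))     = contradiction eq (ax≢by a∈A b∈B)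

        ax-lost : ∀ {a} → a Subset.∈ A → (∀ {b} → b Subset.∈ B → BY-loses b a → R) → R
        ax-lost a∈A f = decidable-stable R? λ ¬R → no-source (ax a∈A) λ e l → ¬R (from e (losing e (ax a∈A) l))
          where
          from : ∀ e → Losing (value e) _ → R
          from e (_ , _ , _ , b∈B , inj₁ (_ , eq , _)) = contradiction eq (ax≢by a∈A b∈B)
          from e (_ , _ , _ , b∈B , inj₂ (_ , eq , l)) with refl ← ax-injective a∈A eq = f b∈B l

        by-loses : ∀ {b} → b Subset.∈ B → (∀ {a} → a Subset.∈ A → BY-loses b a → R) → R
        by-loses b∈B f = decidable-stable R? λ ¬R → no-sink-Δ (by b∈B) λ e l → ¬R (from e (losing (by b∈B) e l))
          where
          from : ∀ e → Losing _ (value e) → R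
          from e (_ , _ , a∈A , _ , inj₁ (eq , _))     = contradiction (sym eq) (ax≢by a∈A b∈B)
          from e (_ , _ , a∈A , _ , inj₂ (eq , _ , l)) with refl ← by-injective b∈B eq = f a∈A l

        by-lost : ∀ {b} → b Subset.∈ B → (∀ {a} → a Subset.∈ A → AX-loses a b → R) → R
        by-lost b∈B f = decidable-stable R? λ ¬R → no-source (by b∈B) λ e l → ¬R (from e (losing e (by b∈B) l))
          where
          from : ∀ e → Losing (value e) _ → R
          from e (_ , _ , a∈A , _ , inj₁ (_ , eq , l)) with refl ← by-injective b∈B eq = f a∈A l
          from e (_ , _ , a∈A , _ , inj₂ (_ , eq , _)) = contradiction (sym eq) (ax≢by a∈A b∈B)

      -- The vertices of the stars form a module.

      pull : ∀ {u v z} → J v → ¬ J z → Unreachable u v → u ⟶ z → v ⟶ z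
      pull Jv ¬Jz far u⟶z with adjacent (λ { refl → ¬Jz Jv }) (¬Jz ∘ proj₂ ∘ edge⇒J)
      ... | inj₁ v⟶z = v⟶z
      -- Here `z` would be the middle of a path from `u` to `v`.
      ... | inj₂ z⟶v = contradiction z⟶v (far u⟶z)

      a₀∈A = proj₂ (Star.leaves-nonempty S₁)

      -- Domination of `z` passes around the cycle from `x` to all of `B`, to all of `A`, to `y` and
      -- back to `x`, each time along an unreachability given by the dependency digraph.
      module _ {z} (¬Jz : ¬ J z) where

        x→b : ∀ {b} → b Subset.∈ B → x ⟶ z → b ⟶ z
        x→b b∈B x⟶z = by-lost (_ ⟶? z) b∈B λ _ (_ , far) → pull (inj₂ (inj₂ b∈B)) ¬Jz far x⟶z

        x→a : ∀ {a} → a Subset.∈ A → x ⟶ z → a ⟶ z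
        -- The leaf of `B` is dictated by the edge that loses to `ax`, so `x→b` is needed for every
        -- leaf of `B`.
        x→a a∈A x⟶z = ax-lost (_ ⟶? z) a∈A λ b∈B (_ , _ , far , _) →
          pull (inj₂ (inj₁ a∈A)) ¬Jz far (x→b b∈B x⟶z)

        a→y : ∀ {a} → a Subset.∈ A → a ⟶ z → y ⟶ z
        a→y a∈A a⟶z = ax-loses (y ⟶? z) a∈A λ _ (far , _) → pull (inj₁ (inj₂ refl)) ¬Jz far a⟶z

        y→x : y ⟶ z → x ⟶ z
        y→x y⟶z = ax-lost (x ⟶? z) a₀∈A λ _ (_ , _ , _ , far) → pull (inj₁ (inj₁ refl)) ¬Jz far y⟶z

        b→x : ∀ {b} → b Subset.∈ B → b ⟶ z → x ⟶ z
        b→x b∈B b⟶z = by-loses (x ⟶? z) b∈B λ a∈A (_ , _ , far , _) →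
          y→x (a→y a∈A (pull (inj₂ (inj₁ a∈A)) ¬Jz far b⟶z))

      from-x : ∀ {u z} → J u → ¬ J z → x ⟶ z → u ⟶ z
      from-x (inj₁ (inj₁ refl)) ¬Jz x⟶z = x⟶z
      from-x (inj₁ (inj₂ refl)) ¬Jz x⟶z = a→y ¬Jz a₀∈A (x→a ¬Jz a₀∈A x⟶z)
      from-x (inj₂ (inj₁ u∈A))  ¬Jz x⟶z = x→a ¬Jz u∈A x⟶z
      from-x (inj₂ (inj₂ u∈B))  ¬Jz x⟶z = x→b ¬Jz u∈B x⟶z

      to-x : ∀ {u z} → J u → ¬ J z → u ⟶ z → x ⟶ z
      to-x (inj₁ (inj₁ refl)) ¬Jz u⟶z = u⟶z
      to-x (inj₁ (inj₂ refl)) ¬Jz u⟶z = y→x ¬Jz u⟶z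
      to-x (inj₂ (inj₁ u∈A))  ¬Jz u⟶z = y→x ¬Jz (a→y ¬Jz u∈A u⟶z)
      to-x (inj₂ (inj₂ u∈B))  ¬Jz u⟶z = b→x ¬Jz u∈B u⟶z

    two-SNP : ∃₂ λ v w → v ≢ w × SecondNeighborhoodProperty D v × SecondNeighborhoodProperty D w
    two-SNP = ModuleOfStars.two-SNP T D x y A B tournament x∉H y∉H D⇒T
      (λ ¬J u⟶v → T⇒D u⟶v (¬J ∘ edge⇒J))
      (λ Hu Hv u⟶v → T⇒D u⟶v λ e → edge⇒¬H e (Hu , Hv))
      x⟶y
      -- Some `by` loses to `ax`, which includes `y ⟶ a`; likewise `by` loses to some `ax`, which
      -- includes `b ⟶ x`.
      (λ a∈A → ax-lost (y ⟶? _) a∈A λ _ (_ , y⟶a , _) → y⟶a)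
      (λ b∈B → by-loses (_ ⟶? x) b∈B λ _ (b⟶x , _) → b⟶x)
      (λ a∈A x⟶a → D⇒¬Edge x⟶a (inj₁ (inj₂ (a∈A , refl))))
      (λ a∈A a⟶x → D⇒¬Edge a⟶x (inj₁ (inj₁ (a∈A , refl))))
      (λ b∈B y⟶b → D⇒¬Edge y⟶b (inj₂ (inj₂ (b∈B , refl))))
      (λ b∈B b⟶y → D⇒¬Edge b⟶y (inj₂ (inj₁ (b∈B , refl))))
      from-x to-x (Star.leaves-nonempty S₁) no-sink

-- The theorem, by the direction of the arc between the centres.

theorem5 :
    (n : ℕ) (T : Digraph n) (S₁ S₂ : Star n) →
    IsTournament T → Disjoint S₁ S₂ →
    let D = T ∖ S₁ ∖ S₂ in
    (∀ e → ¬ Source (LosesTo D) e) →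
    (∀ e → ¬ Sink (LosesTo D) e) →
    (∀ v → ¬ Sink (Digraph._⟶_ D) v) →
    ∃₂ λ (v w : Fin n) → v ≢ w ×
      SecondNeighborhoodProperty D v × SecondNeighborhoodProperty D w
theorem5 n T S₁ S₂ tournament disjoint no-source no-sink-Δ no-sink
  with IsTournament.joined tournament (Star.center S₁) (Star.center S₂)
         (λ eq → disjoint (Star.center S₁ , x∈p∩q⁺
           (x∈p∪q⁺ (inj₁ (x∈⁅x⁆ _)) , x∈p∪q⁺ (inj₁ (Equivalence.from x∈⁅y⁆⇔x≡y eq)))))
... | inj₁ (x⟶y , _) = TwoStars.two-SNP T (T ∖ S₁ ∖ S₂) S₁ S₂ tournament disjoint
  (proj₁ ∘ proj₁)
  (λ ((_ , ¬e₁) , ¬e₂) → [ ¬e₁ , ¬e₂ ]′)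
  (λ u⟶v ¬e → (u⟶v , ¬e ∘ inj₁) , ¬e ∘ inj₂)
  no-source no-sink-Δ no-sink x⟶y
-- The stars change roles so that the dominating centre comes first; `D` is unchanged.
... | inj₂ (y⟶x , _) = TwoStars.two-SNP T (T ∖ S₁ ∖ S₂) S₂ S₁ tournament
  (λ (v , v∈) → disjoint (v , subst (v Subset.∈_) (∩-comm _ _) v∈))
  (proj₁ ∘ proj₁)
  (λ ((_ , ¬e₁) , ¬e₂) → [ ¬e₂ , ¬e₁ ]′)
  (λ u⟶v ¬e → (u⟶v , ¬e ∘ inj₂) , ¬e ∘ inj₁)
  no-source no-sink-Δ no-sink y⟶x
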